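{- For all $n\geq 2$, $AR_{FF}(K_n) = \frac{n^3}{6}(1+o(1))$, where $K_n$ is the complete graph on $n$ vertices and $o(1)$ is a function of $n$ tending to $0$ as $n\to\infty$.
   Context: All graphs are finite and simple. An edge-colored graph is rainbow if all its edges have distinct colors. A copy of $H$ is a (not necessarily induced) subgraph isomorphic to $H$. $AR_{FF}(H)$ (First-Fit anti-Ramsey number): Builder presents vertices and edges of a simple graph, one edge at a time, and each new edge is immediately colored by Painter with the smallest color in $\{1,2,\ldots\}$ not used on an adjacent edge already presented (First-Fit). $AR_{FF}(H)$ is the smallest $t$ such that Builder can present $t$ edges so that the resulting colored graph contains a rainbow copy of $H$. -}

module Defs where

open import Data.Fin using (Fin)
open import Data.Fin.Properties using (_≟_)
open import Data.List using (List; []; _∷_; length)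
open import Data.List.Relation.Unary.All using (All)
open import Data.List.Relation.Unary.Any using (Any)
open import Data.Nat using (ℕ; _≤_)
open import Data.Product using (_×_; _,_; ∃; ∃-syntax)
open import Data.Rational as ℚ using (ℚ; 0ℚ; ∣_∣)
open import Data.Sum using (_⊎_)
open import Function using (_∘_)
open import Function.Definitions using (Injective)
open import Level using (0ℓ)
open import Relation.Binary using (Rel; Symmetric; Irreflexive; Decidable)
open import Relation.Binary.PropositionalEquality using (_≡_; _≢_; sym)
open import Relation.Nullary using (¬_; ¬?)

Least : (ℕ → Set) → ℕ → Set
Least P k = P k × (∀ j → P j → k ≤ j)

record Graph : Set₁ where
  field
    order  : ℕ
    _—_    : Rel (Fin order) 0ℓ
    _—?_   : Decidable _—_
    symm   : Symmetric _—_
    irrefl : Irreflexive _≡_ _—_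

K : ℕ → Graph
K n = record
  { order  = n
  ; _—_    = _≢_
  ; _—?_   = λ u v → ¬? (u ≟ v)
  ; symm   = λ u≢v → u≢v ∘ sym
  ; irrefl = λ u≡v u≢v → u≢v u≡v
  }

-- An unordered pair of vertices is represented by an ordered one; pairs are
-- compared only up to orientation, through _≈_.
Pair : ℕ → Set
Pair m = Fin m × Fin m

infix 4 _≈_

_≈_ : ∀ {m} → Pair m → Pair m → Set
(a , b) ≈ (c , d) = (a ≡ c × b ≡ d) ⊎ (a ≡ d × b ≡ c)

Loopless : ∀ {m} → Pair m → Set
Loopless (a , b) = a ≢ b

Touches : ∀ {m} → Pair m → Pair m → Set
Touches (a , b) (c , d) = (a ≡ c ⊎ a ≡ d) ⊎ (b ≡ c ⊎ b ≡ d)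

record ColouredEdge (m : ℕ) : Set where
  constructor _coloured_
  field
    ends   : Pair m
    colour : ℕ

open ColouredEdge public

Absent : ∀ {m} → Pair m → List (ColouredEdge m) → Set
Absent e = All (λ f → ¬ (e ≈ ends f))

-- c can be given to an edge e that is not yet in the list.
Available : ∀ {m} → List (ColouredEdge m) → Pair m → ℕ → Set
Available fs e c = 1 ≤ c × All (λ f → Touches e (ends f) → c ≢ colour f) fs

-- Games between Builder and the First-Fit Painter on the vertex set Fin m;
-- the most recently presented edge is at the head of the list.
data FirstFit {m : ℕ} : List (ColouredEdge m) → Set where
  start   : FirstFit []
  present : ∀ {fs e c} → FirstFit fs →
            Loopless e → Absent e fs →
            Least (Available fs e) c →
            FirstFit ((e coloured c) ∷ fs)

HasColour : ∀ {m} → List (ColouredEdge m) → Pair m → ℕ → Set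
HasColour fs e c = Any (λ f → e ≈ ends f × c ≡ colour f) fs

record RainbowCopy (H : Graph) {m : ℕ} (fs : List (ColouredEdge m)) : Set where
  open Graph H
  field
    φ         : Fin order → Fin m
    injective : Injective _≡_ _≡_ φ
    edges     : ∀ {u v} → u — v → ∃[ c ] HasColour fs (φ u , φ v) c
    rainbow   : ∀ {u v x y c} → u — v → x — y →
                HasColour fs (φ u , φ v) c → HasColour fs (φ x , φ y) c →
                (u , v) ≈ (x , y)

BuilderCanForce : Graph → ℕ → Set
BuilderCanForce H t =
  ∃[ m ] ∃ λ (fs : List (ColouredEdge m)) →
    FirstFit fs × length fs ≡ t × RainbowCopy H fs

-- IsAR-FF H t says that AR_FF(H) exists and equals t.
IsAR-FF : Graph → ℕ → Set
IsAR-FF H = Least (BuilderCanForce H)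

TendsToZero : (ℕ → ℚ) → Set
TendsToZero o = ∀ ε → 0ℚ ℚ.< ε → ∃[ N ] ∀ n → N ≤ n → ∣ o n ∣ ℚ.< ε

{-# OPTIONS --safe #-}
-- Both bounds are C(n,3) + O(n²).  Below: call a vertex of the rainbow clique
-- blind for colour i if it sees no edge of colour i.  First-Fit gives every
-- edge between two blind vertices a colour below i, so at most s vertices are
-- blind when C(s,2) < i ≤ C(s+1,2), and the other n - s require at least
-- n - s - 1 edges of colour i; summing over i ≤ C(n,2) gives the sum of
-- s (n - 1 - s), which is C(n,3).  Above: Builder adds the clique vertices one
-- at a time; the j-th (counting from 0) first receives C(j,2) pendant edges,
-- which exhaust the colours used so far in the clique, and is then joined to
-- its predecessors, whence C(n,3) + C(n,2) edges.  The least number of edges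
-- exists constructively because whether t edges suffice is decidable: they
-- meet at most 2t vertices, and First-Fit determines the colours.
module Submission where

open import Defs
open import Data.Fin using (Fin; zero; suc; _↑ˡ_; _↑ʳ_; splitAt; fromℕ<; punchIn; finToFun; funToFin)
open import Data.Fin.Properties as Fin
  using (_≟_; finToFun-funToFin; ↑ˡ-injective; ↑ʳ-injective; splitAt-↑ˡ; splitAt-↑ʳ;
         pigeonhole; punchIn-injective; punchInᵢ≢i)
open import Data.List using (List; []; _∷_; _++_; length; map; tabulate; filter; allFin; lookup)
open import Data.List.Membership.Propositional using (_∈_; _∉_; find; lose)
open import Data.List.Membership.Propositional.Properties
  using (∈-++⁺ˡ; ∈-++⁺ʳ; ∈-map⁺; ∈-tabulate⁺; ∈-tabulate⁻; ∈-filter⁺; ∈-filter⁻; ∈-lookup)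
open import Data.List.Properties using (length-++; length-map; length-tabulate; length-filter)
open import Data.List.Relation.Unary.All as All using (All; []; _∷_; all?)
import Data.List.Relation.Unary.All.Properties as All
open import Data.List.Relation.Unary.AllPairs as AllPairs using (AllPairs; []; _∷_)
import Data.List.Relation.Unary.AllPairs.Properties as AllPairs
open import Data.List.Relation.Unary.Any as Any using (Any; here; there; any?; index)
import Data.List.Relation.Unary.Any.Properties as Any
open import Data.List.Relation.Unary.Unique.Propositional using (Unique)
import Data.List.Relation.Unary.Unique.Propositional.Properties as Unique
open import Data.Nat as ℕ using (ℕ; zero; suc; _≤_; _<_; _^_; _∸_; s≤s; z≤n; NonZero)
import Data.Nat.Properties as ℕ
open import Data.List.Extrema ℕ.≤-totalOrder using (max; xs≤max)
open import Data.Nat.Tactic.RingSolver using (solve-∀)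
open import Data.Product as Product using (_×_; _,_; ∃; ∃-syntax; proj₁; proj₂)
open import Data.Sum as Sum using (_⊎_; inj₁; inj₂)
open import Data.Unit using (⊤; tt)
open import Function using (_∘_; id)
open import Relation.Binary.PropositionalEquality
  using (_≡_; _≢_; refl; sym; trans; cong; cong₂; subst; subst₂; module ≡-Reasoning)
open import Relation.Nullary
  using (¬_; Dec; yes; no; contradiction; ¬?; map′; _×-dec_; _⊎-dec_; _→-dec_)
open import Relation.Unary using (Decidable)

module FirstFitCliques where

  open import Data.Nat using (_+_; _*_)

  -- Deciding whether Builder can force a copy

  -- The known witness `k` bounds the search: each step that fails at 0 shifts the predicate by one
  -- and lowers `k`, so 0 is found to satisfy it at the latest when `k` has come down to 0.
  Least-search : ∀ {P : ℕ → Set} → Decidable P → ∀ {k} → P k → ∃ (Least P)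
  Least-search {P} P? {k} pk with P? 0
  Least-search {P} P? {k} pk | yes p0 = 0 , p0 , λ _ _ → z≤n
  Least-search {P} P? {zero} pk | no ¬p0 = contradiction pk ¬p0
  Least-search {P} P? {suc k} pk | no ¬p0
    with l , pl , least ← Least-search (P? ∘ suc) pk
    = suc l , pl , λ where
        zero    p0 → contradiction p0 ¬p0
        (suc j) pj → s≤s (least j pj)

  Least-unique : ∀ {P : ℕ → Set} {k l} → Least P k → Least P l → k ≡ l
  Least-unique (pk , k≤) (pl , l≤) = ℕ.≤-antisym (k≤ _ pl) (l≤ _ pk)

  Least-cong : ∀ {P Q : ℕ → Set} {k} → (∀ {j} → P j → Q j) → (∀ {j} → Q j → P j) →
               Least P k → Least Q k
  Least-cong P⇒Q Q⇒P (pk , k≤) = P⇒Q pk , λ j qj → k≤ j (Q⇒P qj)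

  _≈?_ : ∀ {m} (e f : Pair m) → Dec (e ≈ f)
  (a , b) ≈? (c , d) = (a ≟ c ×-dec b ≟ d) ⊎-dec (a ≟ d ×-dec b ≟ c)

  ≈-sym : ∀ {m} {e f : Pair m} → e ≈ f → f ≈ e
  ≈-sym (inj₁ (refl , refl)) = inj₁ (refl , refl)
  ≈-sym (inj₂ (refl , refl)) = inj₂ (refl , refl)

  ≈-trans : ∀ {m} {e f g : Pair m} → e ≈ f → f ≈ g → e ≈ g
  ≈-trans (inj₁ (refl , refl)) f≈g = f≈g
  ≈-trans (inj₂ (refl , refl)) (inj₁ (refl , refl)) = inj₂ (refl , refl)
  ≈-trans (inj₂ (refl , refl)) (inj₂ (refl , refl)) = inj₁ (refl , refl)

  Touches? : ∀ {m} (e f : Pair m) → Dec (Touches e f)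
  Touches? (a , b) (c , d) = (a ≟ c ⊎-dec a ≟ d) ⊎-dec (b ≟ c ⊎-dec b ≟ d)

  Available? : ∀ {m} (fs : List (ColouredEdge m)) (e : Pair m) → Decidable (Available fs e)
  Available? fs e c =
    1 ℕ.≤? c ×-dec all? (λ f → Touches? e (ends f) →-dec ¬? (c ℕ.≟ colour f)) fs

  firstFit : ∀ {m} (fs : List (ColouredEdge m)) (e : Pair m) → ∃ (Least (Available fs e))
  firstFit fs e = Least-search (Available? fs e)
    -- One more than the largest colour in play is always available, which bounds the search.
    (s≤s z≤n , All.map unused (All.map⁻ (xs≤max 0 (map colour fs))))
    where
    unused : ∀ {f} → colour f ≤ max 0 (map colour fs) →
             Touches e (ends f) → suc (max 0 (map colour fs)) ≢ colour f
    unused c≤max _ max<c = ℕ.<⇒≢ (s≤s c≤max) (sym max<c)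

  -- The last move is absorbed into the predicate: a game of `suc t` edges satisfies `P` exactly
  -- when its first `t` edges allow a move that leads to `P`. The induction therefore needs all
  -- decidable `P` at once. Only the edge of each move is searched for, as its colour is determined.
  anyGame? : ∀ {m} t {P : List (ColouredEdge m) → Set} → Decidable P →
             Dec (∃[ fs ] (FirstFit fs × length fs ≡ t × P fs))
  anyGame? zero P? = map′ (λ p → [] , start , refl , p) (λ { ([] , _ , _ , p) → p }) (P? [])
  anyGame? {m} (suc t) {P} P? = map′ to from (anyGame? t Continues?)
    where
    move : List (ColouredEdge m) → Pair m → List (ColouredEdge m)
    move fs e = (e coloured proj₁ (firstFit fs e)) ∷ fs

    Continues : List (ColouredEdge m) → Set
    Continues fs = ∃[ a ] ∃[ b ] (Loopless (a , b) × Absent (a , b) fs × P (move fs (a , b)))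

    Continues? : Decidable Continues
    Continues? fs = Fin.any? λ a → Fin.any? λ b →
      ¬? (a ≟ b) ×-dec all? (λ f → ¬? ((a , b) ≈? ends f)) fs ×-dec P? (move fs (a , b))

    to : ∃[ fs ] (FirstFit fs × length fs ≡ t × Continues fs) →
         ∃[ fs ] (FirstFit fs × length fs ≡ suc t × P fs)
    to (fs , ff , len , a , b , a≢b , absent , p) =
      move fs (a , b) , present ff a≢b absent (proj₂ (firstFit fs (a , b))) , cong suc len , p

    from : ∃[ fs ] (FirstFit fs × length fs ≡ suc t × P fs) →
           ∃[ fs ] (FirstFit fs × length fs ≡ t × Continues fs)
    from (_ , present {fs} {e} {c} ff a≢b absent least , len , p) =
      fs , ff , ℕ.suc-injective len , _ , _ , a≢b , absent ,
      subst (λ c → P ((e coloured c) ∷ fs)) (Least-unique least (proj₂ (firstFit fs e))) p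

  module _ (H : Graph) {m : ℕ} (fs : List (ColouredEdge m)) where
    open Graph H

    -- `RainbowCopy` quantifies over all colours; here the quantifiers range over vertices and over
    -- the edges of `fs` only, so each of them is finite and decidable.
    IsRainbowCopy : (Fin order → Fin m) → Set
    IsRainbowCopy φ =
      (∀ u v → φ u ≡ φ v → u ≡ v) ×
      (∀ u v → u — v → Any (λ f → (φ u , φ v) ≈ ends f) fs) ×
      (∀ u v x y → u — v → x — y →
        All (λ f → All (λ g → (φ u , φ v) ≈ ends f → (φ x , φ y) ≈ ends g →
                              colour f ≡ colour g → (u , v) ≈ (x , y)) fs) fs)

    IsRainbowCopy? : Decidable IsRainbowCopy
    IsRainbowCopy? φ =
      (Fin.all? λ u → Fin.all? λ v → φ u ≟ φ v →-dec u ≟ v) ×-dec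
      (Fin.all? λ u → Fin.all? λ v → u —? v →-dec any? (λ f → (φ u , φ v) ≈? ends f) fs) ×-dec
      (Fin.all? λ u → Fin.all? λ v → Fin.all? λ x → Fin.all? λ y → u —? v →-dec (x —? y →-dec
        all? (λ f → all? (λ g → (φ u , φ v) ≈? ends f →-dec ((φ x , φ y) ≈? ends g →-dec
                                (colour f ℕ.≟ colour g →-dec (u , v) ≈? (x , y)))) fs) fs))

    toRainbowCopy : ∃ IsRainbowCopy → RainbowCopy H fs
    toRainbowCopy (φ , inj , edge , rain) = record
      { φ         = φ
      ; injective = inj _ _
      ; edges     = λ uv → colourOf (edge _ _ uv)
      ; rainbow   = λ uv xy p q → pick p q (rain _ _ _ _ uv xy)
      }
      where
      colourOf : ∀ {e gs} → Any (λ f → e ≈ ends f) gs → ∃[ c ] HasColour gs e c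
      colourOf (here e≈) = _ , here (e≈ , refl)
      colourOf (there p) = Product.map₂ there (colourOf p)

      pick : ∀ {e e′ c} {Z : Set} → HasColour fs e c → HasColour fs e′ c →
             All (λ f → All (λ g → e ≈ ends f → e′ ≈ ends g → colour f ≡ colour g → Z) fs) fs → Z
      pick p q all
        with h , e≈ , c≡ ← All.lookupAny all p
        with h′ , e′≈ , c≡′ ← All.lookupAny h q
        = h′ e≈ e′≈ (trans (sym c≡) c≡′)

    fromRainbowCopy : RainbowCopy H fs → ∃[ ψ ] IsRainbowCopy ψ
    fromRainbowCopy ρ = φ ,
      (λ _ _ → injective) ,
      (λ _ _ uv → Any.map proj₁ (proj₂ (edges uv))) ,
      (λ _ _ _ _ uv xy → All.tabulate λ f∈ → All.tabulate λ g∈ e≈ e′≈ c≡ →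
        rainbow uv xy (hasColour f∈ e≈ refl) (hasColour g∈ e′≈ c≡))
      where
      open RainbowCopy ρ
      hasColour : ∀ {f e c} → f ∈ fs → e ≈ ends f → c ≡ colour f → HasColour fs e c
      hasColour f∈ e≈ c≡ = Any.map (λ { refl → e≈ , c≡ }) f∈

    -- Maps are enumerated through their codes, and decoding recovers a map only pointwise, so the
    -- property must be invariant under pointwise equality.
    IsRainbowCopy-resp : ∀ {φ ψ} → (∀ u → φ u ≡ ψ u) → IsRainbowCopy φ → IsRainbowCopy ψ
    IsRainbowCopy-resp φ≗ψ (inj , edge , rain) =
      (λ u v eq → inj u v (trans (φ≗ψ u) (trans eq (sym (φ≗ψ v))))) ,
      (λ u v uv → Any.map (subst (_≈ _) (pair u v)) (edge u v uv)) ,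
      (λ u v x y uv xy → All.map (All.map λ h p q →
         h (subst (_≈ _) (sym (pair u v)) p) (subst (_≈ _) (sym (pair x y)) q)) (rain u v x y uv xy))
      where pair = λ u v → cong₂ _,_ (φ≗ψ u) (φ≗ψ v)

    RainbowCopy? : Dec (RainbowCopy H fs)
    RainbowCopy? = map′
      (λ { (k , p) → toRainbowCopy (finToFun k , p) })
      (λ ρ → let φ , p = fromRainbowCopy ρ in
        funToFin φ , IsRainbowCopy-resp (λ u → sym (finToFun-funToFin φ u)) p)
      (Fin.any? (IsRainbowCopy? ∘ finToFun))

  -- Reduction to a bounded number of vertices

  ForcesOn : Graph → ℕ → ℕ → Set
  ForcesOn H m t = ∃ λ (fs : List (ColouredEdge m)) → FirstFit fs × length fs ≡ t × RainbowCopy H fs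

  InjectiveOn : ∀ {A B : Set} → (A → Set) → (A → B) → Set
  InjectiveOn S f = ∀ {u v} → S u → S v → f u ≡ f v → u ≡ v

  Both : ∀ {A : Set} → (A → Set) → A × A → Set
  Both S (a , b) = S a × S b

  -- First-Fit depends only on which edges meet, so a game survives any renaming that is injective
  -- on a set `S` containing the ends of its edges. Outside `S` vertices may be merged, which is
  -- what compressing the vertex set does.
  module Relabelling {m k} (S : Fin m → Set) (f : Fin m → Fin k) (f-inj : InjectiveOn S f) where

    f² : Pair m → Pair k
    f² = Product.map f f

    relabel : ColouredEdge m → ColouredEdge k
    relabel (e coloured c) = f² e coloured c

    Within : List (ColouredEdge m) → Set
    Within = All (Both S ∘ ends)

    ≈-relabel⁺ : ∀ {e e′} → e ≈ e′ → f² e ≈ f² e′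
    ≈-relabel⁺ = Sum.map (Product.map (cong f) (cong f)) (Product.map (cong f) (cong f))

    ≈-relabel⁻ : ∀ {e e′} → Both S e → Both S e′ → f² e ≈ f² e′ → e ≈ e′
    ≈-relabel⁻ (a , b) (c , d) = Sum.map (Product.map (f-inj a c) (f-inj b d)) (Product.map (f-inj a d) (f-inj b c))

    Touches-relabel⁺ : ∀ {e e′} → Touches e e′ → Touches (f² e) (f² e′)
    Touches-relabel⁺ = Sum.map (Sum.map (cong f) (cong f)) (Sum.map (cong f) (cong f))

    Touches-relabel⁻ : ∀ {e e′} → Both S e → Both S e′ → Touches (f² e) (f² e′) → Touches e e′
    Touches-relabel⁻ (a , b) (c , d) =
      Sum.map (Sum.map (f-inj a c) (f-inj a d)) (Sum.map (f-inj b c) (f-inj b d))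

    Available-relabel⁺ : ∀ {fs e c} → Within fs → Both S e →
                         Available fs e c → Available (map relabel fs) (f² e) c
    Available-relabel⁺ w se (1≤c , free) = 1≤c , All.map⁺ (All.zipWith
      (λ (sf , unused) touch → unused (Touches-relabel⁻ se sf touch)) (w , free))

    Available-relabel⁻ : ∀ {fs e c} → Available (map relabel fs) (f² e) c → Available fs e c
    Available-relabel⁻ (1≤c , free) = 1≤c , All.map (_∘ Touches-relabel⁺) (All.map⁻ free)

    FirstFit-relabel : ∀ {fs} → Within fs → FirstFit fs → FirstFit (map relabel fs)
    FirstFit-relabel [] start = start
    FirstFit-relabel (se ∷ w) (present ff a≢b absent least) = present
      (FirstFit-relabel w ff)
      (λ fa≡fb → a≢b (f-inj (proj₁ se) (proj₂ se) fa≡fb))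
      (All.map⁺ (All.zipWith (λ (sf , e≉f) eq → e≉f (≈-relabel⁻ se sf eq)) (w , absent)))
      (Least-cong (Available-relabel⁺ w se) Available-relabel⁻ least)

    HasColour-relabel⁺ : ∀ {fs e c} → HasColour fs e c → HasColour (map relabel fs) (f² e) c
    HasColour-relabel⁺ = Any.map⁺ ∘ Any.map (Product.map₁ ≈-relabel⁺)

    HasColour-relabel⁻ : ∀ {fs e c} → Within fs → Both S e →
                         HasColour (map relabel fs) (f² e) c → HasColour fs e c
    HasColour-relabel⁻ (sf ∷ w) se (here (eq , c≡)) = here (≈-relabel⁻ se sf eq , c≡)
    HasColour-relabel⁻ (sf ∷ w) se (there p)        = there (HasColour-relabel⁻ w se p)

    RainbowCopy-relabel : ∀ {H fs} → Within fs → (ρ : RainbowCopy H fs) →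
                          (∀ u → S (RainbowCopy.φ ρ u)) → RainbowCopy H (map relabel fs)
    RainbowCopy-relabel w ρ s = record
      { φ         = f ∘ φ
      ; injective = injective ∘ f-inj (s _) (s _)
      ; edges     = λ uv → Product.map₂ HasColour-relabel⁺ (edges uv)
      ; rainbow   = λ uv xy p q → rainbow uv xy
                      (HasColour-relabel⁻ w (s _ , s _) p) (HasColour-relabel⁻ w (s _ , s _) q)
      }
      where open RainbowCopy ρ

  -- The label `zero` is the default for all vertices outside `vs`; positions in `vs` are shifted by
  -- one to keep it free.
  indexOf : ∀ {m} (vs : List (Fin m)) → Fin m → Fin (suc (length vs))
  indexOf vs v with any? (v ≟_) vs
  ... | yes v∈ = suc (Any.index v∈)
  ... | no  _  = zero

  indexOf-injectiveOn : ∀ {m} (vs : List (Fin m)) → InjectiveOn (_∈ vs) (indexOf vs)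
  indexOf-injectiveOn vs {u} {v} u∈ v∈ eq with any? (u ≟_) vs | any? (v ≟_) vs
  ... | no  u∉ | _      = contradiction u∈ u∉
  ... | yes _  | no v∉  = contradiction v∈ v∉
  ... | yes p  | yes q  = begin
    u                                ≡⟨ Any.lookup-index p ⟩
    lookup vs (Any.index p) ≡⟨ cong (lookup vs) (Fin.suc-injective eq) ⟩
    lookup vs (Any.index q) ≡⟨ Any.lookup-index q ⟨
    v                                ∎
    where open ≡-Reasoning

  -- The vertices that matter are the images of those of `H` and the two ends of each of the `t`
  -- edges. With the default label this bounds the vertex set in terms of `H` and `t` alone, so that
  -- deciding `BuilderCanForce` becomes a finite search.
  ForcesOn-compress : ∀ {H m t} → ForcesOn H m t → ForcesOn H (suc (Graph.order H + (t + t))) t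
  ForcesOn-compress {H} {m} (fs , ff , refl , ρ) =
    subst (λ k → ForcesOn H (suc k) (length fs)) |vs|
      ( map relabel fs , FirstFit-relabel within ff , length-map relabel fs
      , RainbowCopy-relabel within ρ (λ u → ∈-++⁺ˡ (∈-tabulate⁺ u)))
    where
    open RainbowCopy ρ
    lefts rights vs : List (Fin m)
    lefts  = map (proj₁ ∘ ends) fs
    rights = map (proj₂ ∘ ends) fs
    vs     = tabulate φ ++ lefts ++ rights
    open Relabelling (_∈ vs) (indexOf vs) (indexOf-injectiveOn vs)

    within : Within fs
    within = All.tabulate λ f∈ →
      ∈-++⁺ʳ (tabulate φ) (∈-++⁺ˡ (∈-map⁺ (proj₁ ∘ ends) f∈)) ,
      ∈-++⁺ʳ (tabulate φ) (∈-++⁺ʳ lefts (∈-map⁺ (proj₂ ∘ ends) f∈))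

    |vs| : length vs ≡ Graph.order H + (length fs + length fs)
    |vs| = begin
      length vs
        ≡⟨ length-++ (tabulate φ) ⟩
      length (tabulate φ) + length (lefts ++ rights)
        ≡⟨ cong₂ _+_ (length-tabulate φ) (length-++ lefts) ⟩
      Graph.order H + (length lefts + length rights)
        ≡⟨ cong (Graph.order H +_) (cong₂ _+_ (length-map _ fs) (length-map _ fs)) ⟩
      Graph.order H + (length fs + length fs) ∎
      where open ≡-Reasoning

  BuilderCanForce? : ∀ H → Decidable (BuilderCanForce H)
  BuilderCanForce? H t = map′ (_ ,_) (λ (_ , forces) → ForcesOn-compress {H} forces)
    (anyGame? t (RainbowCopy? H))

  -- Builder's strategy

  Incident : ∀ {m} → Fin m → Pair m → Set
  Incident v (a , b) = v ≡ a ⊎ v ≡ b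

  Fresh : ∀ {m} → List (ColouredEdge m) → Fin m → Set
  Fresh fs v = All (λ f → ¬ Incident v (ends f)) fs

  Fresh⇒absent : ∀ {m} {fs : List (ColouredEdge m)} {v e c} →
                 Incident v e → Fresh fs v → ¬ HasColour fs e c
  Fresh⇒absent v∈e fresh p = let v∉f , e≈f , _ = All.lookupAny fresh p in v∉f (transport v∈e e≈f)
    where
    transport : ∀ {m} {v : Fin m} {e f} → Incident v e → e ≈ f → Incident v f
    transport (inj₁ refl) (inj₁ (refl , _)) = inj₁ refl
    transport (inj₁ refl) (inj₂ (refl , _)) = inj₂ refl
    transport (inj₂ refl) (inj₁ (_ , refl)) = inj₂ refl
    transport (inj₂ refl) (inj₂ (_ , refl)) = inj₁ refl

  -- Spokes are presented from the end of the list; when the spoke to t is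
  -- drawn, the centre carries exactly the colours 1, …, length ts.
  Admissible : ∀ {m} → List (ColouredEdge m) → List (Fin m) → Set
  Admissible fs []       = ⊤
  Admissible fs (t ∷ ts) =
    All (λ f → Incident t (ends f) → colour f ≤ length ts) fs × Admissible fs ts

  Admissible-fresh : ∀ {m} {fs : List (ColouredEdge m)} {ts} → All (Fresh fs) ts → Admissible fs ts
  Admissible-fresh []             = tt
  Admissible-fresh (fresh ∷ rest) =
    All.map (λ t∉ t∈ → contradiction t∈ t∉) fresh , Admissible-fresh rest

  -- The spokes to `ts` are drawn after those to `us`, hence with more than `length us` colours
  -- reached at the centre, and no old edge has a colour above `length us`.
  Admissible-++ : ∀ {m} {fs : List (ColouredEdge m)} {us} ts → All (λ f → colour f ≤ length us) fs →
                  Admissible fs us → Admissible fs (ts ++ us)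
  Admissible-++ []       small adm = adm
  Admissible-++ {us = us} (_ ∷ ts) small adm =
    All.map (λ c≤ _ → ℕ.≤-trans c≤ us≤) small , Admissible-++ ts small adm
    where us≤ = subst (length us ≤_) (sym (length-++ ts)) (ℕ.m≤n+m (length us) (length ts))

  star : ∀ {m} → Fin m → List (Fin m) → List (ColouredEdge m)
  star x []       = []
  star x (t ∷ ts) = ((x , t) coloured suc (length ts)) ∷ star x ts

  module _ {m} {x : Fin m} where

    length-star : ∀ ts → length (star x ts) ≡ length ts
    length-star []       = refl
    length-star (_ ∷ ts) = cong suc (length-star ts)

    star-colour≤ : ∀ ts → All (λ f → colour f ≤ length ts) (star x ts)
    star-colour≤ []       = []
    star-colour≤ (_ ∷ ts) = ℕ.≤-refl ∷ All.map ℕ.m≤n⇒m≤1+n (star-colour≤ ts)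

    star-spokes : ∀ ts → All (λ f → ∃[ t ] (t ∈ ts × ends f ≡ (x , t))) (star x ts)
    star-spokes []       = []
    star-spokes (t ∷ ts) = (t , here refl , refl) ∷
      All.map (λ (u , u∈ , eq) → u , there u∈ , eq) (star-spokes ts)

    star-saturated : ∀ ts {j} → 1 ≤ j → j ≤ length ts →
                     Any (λ f → Incident x (ends f) × j ≡ colour f) (star x ts)
    star-saturated [] (s≤s _) ()
    star-saturated (t ∷ ts) 1≤j j≤ with ℕ.m≤n⇒m<n∨m≡n j≤
    ... | inj₁ (s≤s j≤′) = there (star-saturated ts 1≤j j≤′)
    ... | inj₂ j≡        = here (inj₁ refl , j≡)

    star-hasColour : ∀ {t ts} → t ∈ ts → ∃ (HasColour (star x ts) (x , t))
    star-hasColour (here refl) = _ , here (inj₁ (refl , refl) , refl)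
    star-hasColour (there t∈)  = Product.map₂ there (star-hasColour t∈)

    HasColour-star⇒∈ : ∀ {t ts c} → x ≢ t → HasColour (star x ts) (x , t) c → t ∈ ts
    HasColour-star⇒∈ {ts = _ ∷ _} x≢t (here (inj₁ (_ , t≡) , _)) = here t≡
    HasColour-star⇒∈ {ts = _ ∷ _} x≢t (here (inj₂ (_ , t≡) , _)) = contradiction (sym t≡) x≢t
    HasColour-star⇒∈ {ts = _ ∷ _} x≢t (there p) = there (HasColour-star⇒∈ x≢t p)

    HasColour-star≤ : ∀ {e ts c} → HasColour (star x ts) e c → c ≤ length ts
    HasColour-star≤ {ts = ts} p =
      let col≤ , _ , c≡ = All.lookupAny (star-colour≤ ts) p in subst (_≤ length ts) (sym c≡) col≤

    star-rainbow : ∀ {t u ts c} → x ≢ t → x ≢ u →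
                   HasColour (star x ts) (x , t) c → HasColour (star x ts) (x , u) c → t ≡ u
    star-rainbow {ts = _ ∷ _} x≢t x≢u (here (inj₂ (_ , t≡) , _)) _ = contradiction (sym t≡) x≢t
    star-rainbow {ts = _ ∷ _} x≢t x≢u _ (here (inj₂ (_ , u≡) , _)) = contradiction (sym u≡) x≢u
    star-rainbow {ts = _ ∷ _} x≢t x≢u (here (inj₁ (_ , t≡) , _)) (here (inj₁ (_ , u≡) , _)) =
      trans t≡ (sym u≡)
    star-rainbow {ts = _ ∷ _} x≢t x≢u (here (_ , refl)) (there q) = contradiction (HasColour-star≤ q) ℕ.1+n≰n
    star-rainbow {ts = _ ∷ _} x≢t x≢u (there p) (here (_ , refl)) = contradiction (HasColour-star≤ p) ℕ.1+n≰n
    star-rainbow {ts = _ ∷ _} x≢t x≢u (there p) (there q) = star-rainbow x≢t x≢u p q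

    -- The spokes to `us`, drawn first, take the colours `1` to `length us`, so every later spoke
    -- has a larger colour. This separates new clique edges from old ones.
    star-++-colour> : ∀ {t us c} ts → x ≢ t → t ∉ us →
                      HasColour (star x (ts ++ us)) (x , t) c → length us < c
    star-++-colour> []       x≢t t∉us p = contradiction (HasColour-star⇒∈ x≢t p) t∉us
    star-++-colour> {us = us} (_ ∷ ts) x≢t t∉us (here (_ , refl)) =
      s≤s (subst (length us ≤_) (sym (length-++ ts)) (ℕ.m≤n+m (length us) (length ts)))
    star-++-colour> (_ ∷ ts) x≢t t∉us (there p) = star-++-colour> ts x≢t t∉us p

    -- Earlier spokes occupy exactly the colours `1` to `length ts` at the fresh centre, which rules
    -- out every smaller colour; admissibility keeps colour `suc (length ts)` free at `t`.
    FirstFit-star : ∀ {fs ts} → FirstFit fs → Fresh fs x → All (x ≢_) ts → Unique ts →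
                    Admissible fs ts → FirstFit (star x ts ++ fs)
    FirstFit-star {ts = []} ff _ _ _ _ = ff
    FirstFit-star {fs} {t ∷ ts} ff fresh (x≢t ∷ x∉) (t∉ ∷ uniq) (low , adm) =
      present (FirstFit-star ff fresh x∉ uniq adm) x≢t
        (All.++⁺ (All.map (λ {f} → notSpoke {f}) (star-spokes ts)) (All.map (λ {f} → notOld {f}) fresh))
        ((s≤s z≤n , All.++⁺
            (All.map (λ c≤ _ c≡ → ℕ.<-irrefl (sym c≡) (s≤s c≤)) (star-colour≤ ts))
            (All.zipWith unused (fresh , low))) ,
         least)
      where
      notSpoke : ∀ {f} → ∃[ u ] (u ∈ ts × ends f ≡ (x , u)) → ¬ ((x , t) ≈ ends f)
      notSpoke (u , u∈ , refl) (inj₁ (_ , t≡u)) = All.lookup t∉ u∈ t≡u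
      notSpoke (u , u∈ , refl) (inj₂ (_ , t≡x)) = x≢t (sym t≡x)

      notOld : ∀ {f} → ¬ Incident x (ends f) → ¬ ((x , t) ≈ ends f)
      notOld x∉f (inj₁ (x≡ , _)) = x∉f (inj₁ x≡)
      notOld x∉f (inj₂ (x≡ , _)) = x∉f (inj₂ x≡)

      unused : ∀ {f} → ¬ Incident x (ends f) × (Incident t (ends f) → colour f ≤ length ts) →
               Touches (x , t) (ends f) → suc (length ts) ≢ colour f
      unused (x∉f , _) (inj₁ x∈f) = contradiction x∈f x∉f
      unused (_ , low) (inj₂ t∈f) c≡ = ℕ.<⇒≢ (s≤s (low t∈f)) (sym c≡)

      least : ∀ j → Available (star x ts ++ fs) (x , t) j → suc (length ts) ≤ j
      least j (1≤j , free) with suc (length ts) ℕ.≤? j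
      ... | yes c≤j = c≤j
      ... | no  c≰j =
        let unused , x∈f , j≡ = All.lookupAny (All.++⁻ˡ (star x ts) free)
                                  (star-saturated ts 1≤j (ℕ.≤-pred (ℕ.≰⇒> c≰j)))
        in contradiction j≡ (unused (inj₁ x∈f))

  -- Building the clique vertex by vertex

  ↑ˡ≢↑ʳ : ∀ {m n} (i : Fin m) (j : Fin n) → i ↑ˡ n ≢ m ↑ʳ j
  ↑ˡ≢↑ʳ {m} {n} i j eq
    with () ← trans (sym (splitAt-↑ˡ m i n)) (trans (cong (splitAt m) eq) (splitAt-↑ʳ m n j))

  -- The binomial coefficient C(n,2).
  tri : ℕ → ℕ
  tri zero    = 0
  tri (suc n) = n + tri n

  -- The binomial coefficient C(n+1,3) = C(n,3) + C(n,2).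
  gameLength : ℕ → ℕ
  gameLength zero    = 0
  gameLength (suc n) = tri (suc n) + gameLength n

  -- The bound `colour≤` covers pendant edges as well as clique edges. It is the invariant that
  -- makes `tri n` pendant edges at the next vertex enough to exhaust all colours used so far.
  record CliqueGame (n : ℕ) : Set where
    field
      {m}      : ℕ
      {fs}     : List (ColouredEdge m)
      isGame   : FirstFit fs
      length≡  : length fs ≡ gameLength n
      colour≤  : All (λ f → colour f ≤ tri n) fs
      copy     : RainbowCopy (K n) fs

  module AddVertex {n} (game : CliqueGame n) where
    open CliqueGame game
    open RainbowCopy copy

    old : Fin m → Fin (suc (tri n + m))
    old v = suc (tri n ↑ʳ v)

    old-injective : ∀ {u v} → old u ≡ old v → u ≡ v
    old-injective eq = ↑ʳ-injective (tri n) _ _ (Fin.suc-injective eq)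

    open Relabelling (λ _ → ⊤) old (λ _ _ → old-injective)

    within : Within fs
    within = All.universal (λ _ → tt , tt) fs

    centre : Fin (suc (tri n + m))
    centre = zero

    leaf : Fin (tri n) → Fin (suc (tri n + m))
    leaf i = suc (i ↑ˡ m)

    spoke : Fin n → Fin (suc (tri n + m))
    spoke = old ∘ φ

    leaves spokes targets : List (Fin (suc (tri n + m)))
    leaves  = tabulate leaf
    spokes  = tabulate spoke
    -- A star is presented from the end of its list, so the leaves come first and use up the colours
    -- `1` to `tri n`.
    targets = spokes ++ leaves

    oldEdges newEdges : List (ColouredEdge (suc (tri n + m)))
    oldEdges = map relabel fs
    newEdges = star centre targets

    spoke-injective : ∀ {i j} → spoke i ≡ spoke j → i ≡ j
    spoke-injective = injective ∘ old-injective

    spoke≢leaf : ∀ {v i} → old v ≢ leaf i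
    spoke≢leaf eq = ↑ˡ≢↑ʳ _ _ (sym (Fin.suc-injective eq))

    spoke∉leaves : ∀ {v} → old v ∉ leaves
    spoke∉leaves v∈ = spoke≢leaf (proj₂ (∈-tabulate⁻ v∈))

    fresh : ∀ {v} → (∀ u → v ≢ old u) → Fresh oldEdges v
    fresh v≢ = All.map⁺ (All.universal (λ _ → Sum.[ v≢ _ , v≢ _ ]) fs)

    length-leaves : length leaves ≡ tri n
    length-leaves = length-tabulate leaf

    length-targets : length targets ≡ tri (suc n)
    length-targets = trans (length-++ spokes) (cong₂ _+_ (length-tabulate spoke) length-leaves)

    oldColour≤ : All (λ f → colour f ≤ tri n) oldEdges
    oldColour≤ = All.map⁺ colour≤

    uniqueTargets : Unique targets
    uniqueTargets = Unique.++⁺ (Unique.tabulate⁺ spoke-injective)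
      (Unique.tabulate⁺ (λ eq → ↑ˡ-injective m _ _ (Fin.suc-injective eq)))
      λ (v∈ , v∈′) → let i , eq = ∈-tabulate⁻ v∈ in spoke∉leaves (subst (_∈ leaves) eq v∈′)

    isGame⁺ : FirstFit (newEdges ++ oldEdges)
    isGame⁺ = FirstFit-star (FirstFit-relabel within isGame) (fresh λ _ ())
      (All.++⁺ (All.tabulate⁺ {f = spoke} λ _ ()) (All.tabulate⁺ {f = leaf} λ _ ())) uniqueTargets
      -- The leaves are isolated in the old game and so impose no condition; when the first clique
      -- edge is drawn, the centre already carries `tri n` colours, and no old colour exceeds
      -- `tri n`.
      (Admissible-++ spokes (subst (λ k → All (λ f → colour f ≤ k) oldEdges) (sym length-leaves) oldColour≤)
        (Admissible-fresh (All.tabulate⁺ {f = leaf} λ i → fresh λ _ eq → spoke≢leaf (sym eq))))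

    φ⁺ : Fin (suc n) → Fin (suc (tri n + m))
    φ⁺ zero    = centre
    φ⁺ (suc i) = spoke i

    -- A coloured clique pair is either a spoke at the new vertex, in one of the two orientations,
    -- or a pair of the smaller clique with its colour in the old game.
    data Origin : Pair (suc n) → ℕ → Set where
      onNew : ∀ {e c} i → e ≈ (zero , suc i) → HasColour newEdges (centre , spoke i) c → Origin e c
      onOld : ∀ {i j c} → i ≢ j → HasColour fs (φ i , φ j) c → Origin (suc i , suc j) c

    HasColour-swap : ∀ {m} {fs : List (ColouredEdge m)} {a b c} →
                     HasColour fs (a , b) c → HasColour fs (b , a) c
    HasColour-swap = Any.map (Product.map₁ (≈-trans (inj₂ (refl , refl))))

    new-origin : ∀ {i c} → HasColour (newEdges ++ oldEdges) (centre , spoke i) c →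
                 HasColour newEdges (centre , spoke i) c
    new-origin p with Any.++⁻ newEdges p
    ... | inj₁ q = q
    ... | inj₂ q = contradiction q (Fresh⇒absent (inj₁ refl) (fresh λ _ ()))

    origin : ∀ {u v c} → u ≢ v → HasColour (newEdges ++ oldEdges) (φ⁺ u , φ⁺ v) c → Origin (u , v) c
    origin {zero}  {zero}  u≢v p = contradiction refl u≢v
    origin {zero}  {suc j} u≢v p = onNew j (inj₁ (refl , refl)) (new-origin p)
    origin {suc i} {zero}  u≢v p = onNew i (inj₂ (refl , refl)) (new-origin (HasColour-swap p))
    origin {suc i} {suc j} u≢v p with Any.++⁻ newEdges p
    ... | inj₂ q = onOld (u≢v ∘ cong suc) (HasColour-relabel⁻ within (tt , tt) q)
    ... | inj₁ q = let (_ , _ , eq) , e≈ , _ = All.lookupAny (star-spokes targets) q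
                   in contradiction (subst ((spoke i , spoke j) ≈_) eq e≈)
                        λ { (inj₁ (() , _)) ; (inj₂ (_ , ())) }

    new-colour> : ∀ {i c} → HasColour newEdges (centre , spoke i) c → tri n < c
    new-colour> p = subst (_< _) length-leaves (star-++-colour> spokes (λ ()) spoke∉leaves p)

    old-colour≤ : ∀ {e c} → HasColour fs e c → c ≤ tri n
    old-colour≤ p = let c≤ , _ , c≡ = All.lookupAny colour≤ p in subst (_≤ tri n) (sym c≡) c≤

    -- Old colours are at most `tri n` and those of new clique edges exceed it, so a repeated colour
    -- can only occur within one kind. There the star gives distinct colours to distinct spokes, and
    -- the old copy is rainbow.
    origin-unique : ∀ {e e′ c} → Origin e c → Origin e′ c → e ≈ e′
    origin-unique (onNew i e≈ p) (onNew j e′≈ q)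
      with refl ← spoke-injective (star-rainbow (λ ()) (λ ()) p q) = ≈-trans e≈ (≈-sym e′≈)
    origin-unique (onNew _ _ p) (onOld _ q) = contradiction (new-colour> p) (ℕ.≤⇒≯ (old-colour≤ q))
    origin-unique (onOld _ p) (onNew _ _ q) = contradiction (new-colour> q) (ℕ.≤⇒≯ (old-colour≤ p))
    origin-unique (onOld i≢j p) (onOld k≢l q) =
      Sum.map (Product.map (cong suc) (cong suc)) (Product.map (cong suc) (cong suc)) (rainbow i≢j k≢l p q)

    φ⁺-injective : ∀ {u v} → φ⁺ u ≡ φ⁺ v → u ≡ v
    φ⁺-injective {zero}  {zero}  eq = refl
    φ⁺-injective {suc _} {suc _} eq = cong suc (spoke-injective eq)

    newEdge : ∀ i → ∃ (HasColour (newEdges ++ oldEdges) (centre , spoke i))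
    newEdge i = Product.map₂ Any.++⁺ˡ (star-hasColour (∈-++⁺ˡ (∈-tabulate⁺ i)))

    edges⁺ : ∀ {u v} → u ≢ v → ∃ (HasColour (newEdges ++ oldEdges) (φ⁺ u , φ⁺ v))
    edges⁺ {zero}  {zero}  u≢v = contradiction refl u≢v
    edges⁺ {zero}  {suc j} u≢v = newEdge j
    edges⁺ {suc i} {zero}  u≢v = Product.map₂ HasColour-swap (newEdge i)
    edges⁺ {suc i} {suc j} u≢v =
      Product.map₂ (Any.++⁺ʳ newEdges ∘ HasColour-relabel⁺) (edges (u≢v ∘ cong suc))

    game⁺ : CliqueGame (suc n)
    game⁺ = record
      { isGame   = isGame⁺
      ; length≡  = trans (length-++ newEdges) (cong₂ _+_
                     (trans (length-star targets) length-targets) (trans (length-map relabel fs) length≡))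
      ; colour≤  = All.++⁺
                     (subst (λ k → All (λ f → colour f ≤ k) newEdges) length-targets (star-colour≤ targets))
                     (All.map (λ c≤ → ℕ.≤-trans c≤ (ℕ.m≤n+m (tri n) n)) oldColour≤)
      ; copy     = record
          { φ         = φ⁺
          ; injective = φ⁺-injective
          ; edges     = edges⁺
          ; rainbow   = λ u≢v x≢y p q → origin-unique (origin u≢v p) (origin x≢y q)
          }
      }

  cliqueGame : ∀ n → CliqueGame n
  cliqueGame zero = record
    { m        = 0
    ; isGame   = start
    ; length≡  = refl
    ; colour≤  = []
    ; copy     = record
        { φ         = λ ()
        ; injective = λ {u} → contradiction u λ ()
        ; edges     = λ {u} → contradiction u λ ()
        ; rainbow   = λ {u} → contradiction u λ ()
        }
    }
  cliqueGame (suc n) = AddVertex.game⁺ (cliqueGame n)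

  canForce-gameLength : ∀ n → BuilderCanForce (K n) (gameLength n)
  canForce-gameLength n = let open CliqueGame (cliqueGame n) in m , fs , isGame , length≡ , copy

  -- Closed forms for the length of the game

  2*tri : ∀ n → 2 * tri n + n ≡ n * n
  2*tri zero    = refl
  2*tri (suc n) = begin
    2 * (n + tri n) + suc n     ≡⟨ lemma n (tri n) ⟩
    (2 * tri n + n) + (2 * n + 1) ≡⟨ cong (_+ (2 * n + 1)) (2*tri n) ⟩
    n * n + (2 * n + 1)         ≡⟨ lemma′ n ⟩
    suc n * suc n               ∎
    where
    open ≡-Reasoning
    lemma : ∀ n t → 2 * (n + t) + suc n ≡ (2 * t + n) + (2 * n + 1)
    lemma = solve-∀
    lemma′ : ∀ n → n * n + (2 * n + 1) ≡ suc n * suc n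
    lemma′ = solve-∀

  6*gameLength : ∀ n → 6 * gameLength n + n ≡ n * n * n
  6*gameLength zero    = refl
  6*gameLength (suc n) = begin
    6 * (n + tri n + gameLength n) + suc n
      ≡⟨ lemma n (tri n) (gameLength n) ⟩
    3 * (2 * tri n + n) + (6 * gameLength n + n) + (3 * n + 1)
      ≡⟨ cong₂ (λ x y → 3 * x + y + (3 * n + 1)) (2*tri n) (6*gameLength n) ⟩
    3 * (n * n) + n * n * n + (3 * n + 1)
      ≡⟨ lemma′ n ⟩
    suc n * suc n * suc n ∎
    where
    open ≡-Reasoning
    lemma : ∀ n t g → 6 * (n + t + g) + suc n ≡ 3 * (2 * t + n) + (6 * g + n) + (3 * n + 1)
    lemma = solve-∀
    lemma′ : ∀ n → 3 * (n * n) + n * n * n + (3 * n + 1) ≡ suc n * suc n * suc n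
    lemma′ = solve-∀

  -- The lower bound

  -- If at most one unordered pair collides, removing one of its members leaves an injective map.
  -- This fits a rainbow clique, which has at most one edge of any given colour.
  pigeonhole-pair : ∀ {w e} (h : Fin w → Fin e) →
    (∀ {i j k l} → i ≢ j → k ≢ l → h i ≡ h j → h k ≡ h l → (i , j) ≈ (k , l)) → w ≤ suc e
  pigeonhole-pair {zero}  h _ = z≤n
  pigeonhole-pair {suc w} {e} h unique with w ℕ.≤? e
  ... | yes w≤e = s≤s w≤e
  ... | no  w≰e
    with i , j , i<j , hi≡hj ← pigeonhole (ℕ.m≤n⇒m≤1+n (ℕ.≰⇒> w≰e)) h
    -- The map `punchIn i` deletes `i` from the domain, so the second collision avoids `i` and
    -- cannot be the same pair as the first.
    with k , l , k<l , hk≡hl ← pigeonhole (ℕ.≰⇒> w≰e) (h ∘ punchIn i)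
    with unique (Fin.<⇒≢ i<j) (Fin.<⇒≢ k<l ∘ punchIn-injective i k l) hi≡hj hk≡hl
  ... | inj₁ (i≡ , _) = contradiction (sym i≡) (punchInᵢ≢i i k)
  ... | inj₂ (i≡ , _) = contradiction (sym i≡) (punchInᵢ≢i i l)

  -- A general symmetric relation serves both uses: vertices up to equality, and pairs up to
  -- orientation.
  AllPairs-lookup-injective : ∀ {A : Set} {_~_ : A → A → Set} {xs} →
    (∀ {x y} → x ~ y → y ~ x) → AllPairs (λ x y → ¬ (x ~ y)) xs →
    ∀ i j → lookup xs i ~ lookup xs j → i ≡ j
  AllPairs-lookup-injective ~-sym (_  ∷ _)   zero    zero    _ = refl
  AllPairs-lookup-injective ~-sym (x≁ ∷ _)   zero    (suc j) x~ =
    contradiction x~ (All.lookup x≁ (∈-lookup j))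
  AllPairs-lookup-injective ~-sym (x≁ ∷ _)   (suc i) zero    ~x =
    contradiction (~-sym ~x) (All.lookup x≁ (∈-lookup i))
  AllPairs-lookup-injective ~-sym (_  ∷ xs≁) (suc i) (suc j) ~ =
    cong suc (AllPairs-lookup-injective ~-sym xs≁ i j ~)

  length-filter-+¬ : ∀ {A : Set} {P : A → Set} (P? : Decidable P) xs →
    length xs ≡ length (filter P? xs) + length (filter (¬? ∘ P?) xs)
  length-filter-+¬ P? [] = refl
  length-filter-+¬ P? (x ∷ xs) with P? x
  ... | yes _ = cong suc (length-filter-+¬ P? xs)
  ... | no  _ = trans (cong suc (length-filter-+¬ P? xs)) (sym (ℕ.+-suc _ _))

  length-filter-disjoint : ∀ {A : Set} {P Q R : A → Set}
    (P? : Decidable P) (Q? : Decidable Q) (R? : Decidable R) →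
    (∀ {x} → P x → R x) → (∀ {x} → Q x → R x) → (∀ {x} → P x → ¬ Q x) →
    ∀ xs → length (filter P? xs) + length (filter Q? xs) ≤ length (filter R? xs)
  length-filter-disjoint P? Q? R? P⊆R Q⊆R P∩Q [] = z≤n
  length-filter-disjoint P? Q? R? P⊆R Q⊆R P∩Q (x ∷ xs)
    with ih ← length-filter-disjoint P? Q? R? P⊆R Q⊆R P∩Q xs
    with P? x | Q? x | R? x
  ... | yes p | yes q | _     = contradiction q (P∩Q p)
  ... | yes p | no  _ | no ¬r = contradiction (P⊆R p) ¬r
  ... | no  _ | yes q | no ¬r = contradiction (Q⊆R q) ¬r
  ... | yes _ | no  _ | yes _ = s≤s ih
  ... | no  _ | yes _ | yes _ = ℕ.≤-trans (ℕ.≤-reflexive (ℕ.+-suc _ _)) (s≤s ih)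
  ... | no  _ | no  _ | yes _ = ℕ.m≤n⇒m≤1+n ih
  ... | no  _ | no  _ | no  _ = ih

  pairs : ∀ {A : Set} → List A → List (A × A)
  pairs []       = []
  pairs (x ∷ xs) = map (x ,_) xs ++ pairs xs

  length-pairs : ∀ {A : Set} (xs : List A) → length (pairs xs) ≡ tri (length xs)
  length-pairs []       = refl
  length-pairs (x ∷ xs) =
    trans (length-++ (map (x ,_) xs)) (cong₂ _+_ (length-map (x ,_) xs) (length-pairs xs))

  pairs-All : ∀ {A : Set} {R : A → A → Set} {xs} → AllPairs R xs → All (λ (x , y) → R x y) (pairs xs)
  pairs-All []        = []
  pairs-All (rx ∷ rs) = All.++⁺ (All.map⁺ rx) (pairs-All rs)

  All⇒AllPairs : ∀ {A : Set} {P : A → Set} {xs} → All P xs → AllPairs (λ x y → P x × P y) xs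
  All⇒AllPairs []       = []
  All⇒AllPairs (p ∷ ps) = All.map (p ,_) ps ∷ All⇒AllPairs ps

  pairs-distinct : ∀ {m} {xs : List (Fin m)} → Unique xs → AllPairs (λ p q → ¬ (p ≈ q)) (pairs xs)
  pairs-distinct []         = []
  pairs-distinct {xs = x ∷ xs} (x∉ ∷ uniq) = AllPairs.++⁺
    (AllPairs.map⁺ (AllPairs.map (λ a≢b → λ where
      (inj₁ (_ , a≡b))   → a≢b a≡b
      (inj₂ (x≡b , a≡x)) → a≢b (trans a≡x x≡b)) uniq))
    (pairs-distinct uniq)
    (All.map⁺ (All.universal (λ _ → All.map
      (λ (x≢c , x≢d) → λ where
        (inj₁ (x≡c , _)) → x≢c x≡c
        (inj₂ (x≡d , _)) → x≢d x≡d) (pairs-All (All⇒AllPairs x∉))) xs))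

  tri-mono : ∀ {k l} → k ≤ l → tri k ≤ tri l
  tri-mono z≤n       = z≤n
  tri-mono (s≤s k≤l) = ℕ.+-mono-≤ k≤l (tri-mono k≤l)

  -- Clique vertices that see or miss a colour

  Incident? : ∀ {m} (v : Fin m) (e : Pair m) → Dec (Incident v e)
  Incident? v (a , b) = v ≟ a ⊎-dec v ≟ b

  Sees : ∀ {m} → List (ColouredEdge m) → ℕ → Fin m → Set
  Sees fs i v = Any (λ f → Incident v (ends f) × colour f ≡ i) fs

  Sees? : ∀ {m} (fs : List (ColouredEdge m)) i → Decidable (Sees fs i)
  Sees? fs i v = any? (λ f → Incident? v (ends f) ×-dec colour f ℕ.≟ i) fs

  -- First-Fit never skips a colour that is free at both ends.
  unseen⇒colour< : ∀ {m} {fs : List (ColouredEdge m)} {a b c i} → FirstFit fs → 1 ≤ i →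
                   HasColour fs (a , b) c → ¬ Sees fs i a → ¬ Sees fs i b → c < i
  unseen⇒colour< (present ff _ _ _) 1≤i (there p) ¬a ¬b =
    unseen⇒colour< ff 1≤i p (¬a ∘ there) (¬b ∘ there)
  unseen⇒colour< {fs = _ ∷ fs} {a} {b} {i = i} (present _ _ _ (_ , least)) 1≤i (here (eq , refl)) ¬a ¬b =
    ℕ.≤∧≢⇒< (least i (1≤i , All.zipWith (free eq)
      (All.¬Any⇒All¬ fs (¬a ∘ there) , All.¬Any⇒All¬ fs (¬b ∘ there)))) (¬a ∘ here ∘ (meets eq ,_))
    where
    free : ∀ {e f} → (a , b) ≈ e →
           ¬ (Incident a (ends f) × colour f ≡ i) × ¬ (Incident b (ends f) × colour f ≡ i) →
           Touches e (ends f) → i ≢ colour f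
    free (inj₁ (refl , refl)) (¬a , ¬b) (inj₁ a∈f) i≡ = ¬a (a∈f , sym i≡)
    free (inj₁ (refl , refl)) (¬a , ¬b) (inj₂ b∈f) i≡ = ¬b (b∈f , sym i≡)
    free (inj₂ (refl , refl)) (¬a , ¬b) (inj₁ b∈f) i≡ = ¬b (b∈f , sym i≡)
    free (inj₂ (refl , refl)) (¬a , ¬b) (inj₂ a∈f) i≡ = ¬a (a∈f , sym i≡)
    meets : ∀ {e} → (a , b) ≈ e → Incident a e
    meets (inj₁ (a≡ , _)) = inj₁ a≡
    meets (inj₂ (a≡ , _)) = inj₂ a≡

  FirstFit⇒1≤colour : ∀ {m} {fs : List (ColouredEdge m)} → FirstFit fs → All (λ f → 1 ≤ colour f) fs
  FirstFit⇒1≤colour start                                  = []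
  FirstFit⇒1≤colour (present ff _ _ ((1≤c , _) , _)) = 1≤c ∷ FirstFit⇒1≤colour ff

  incident-two : ∀ {m} {u v : Fin m} {e} → u ≢ v → Incident u e → Incident v e → (u , v) ≈ e
  incident-two u≢v (inj₁ refl) (inj₁ refl) = contradiction refl u≢v
  incident-two u≢v (inj₁ refl) (inj₂ refl) = inj₁ (refl , refl)
  incident-two u≢v (inj₂ refl) (inj₁ refl) = inj₂ (refl , refl)
  incident-two u≢v (inj₂ refl) (inj₂ refl) = contradiction refl u≢v

  module LowerBound {n m} {fs : List (ColouredEdge m)} (isGame : FirstFit fs)
                    (copy : RainbowCopy (K n) fs) where
    open RainbowCopy copy

    ofColour upTo : ℕ → List (ColouredEdge m)
    ofColour i = filter (λ f → colour f ℕ.≟ i) fs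
    upTo i     = filter (λ f → colour f ℕ.≤? i) fs

    seeing blind : ℕ → List (Fin n)
    seeing i = filter (Sees? fs i ∘ φ) (allFin n)
    blind  i = filter (¬? ∘ Sees? fs i ∘ φ) (allFin n)

    -- An edge of colour i meets at most one clique vertex, except that the
    -- single clique edge of colour i meets two.
    length-seeing : ∀ i → length (seeing i) ≤ suc (length (ofColour i))
    length-seeing i = pigeonhole-pair (λ k → index (proj₁ (proj₂ (edgeAt k)))) unique
      where
      vertex : Fin (length (seeing i)) → Fin n
      vertex = lookup (seeing i)

      vertex-injective : ∀ {k l} → vertex k ≡ vertex l → k ≡ l
      vertex-injective = AllPairs-lookup-injective sym
        (Unique.filter⁺ (Sees? fs i ∘ φ) (Unique.allFin⁺ n)) _ _

      Via : Fin m → Set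
      Via v = ∃[ f ] (f ∈ ofColour i × Incident v (ends f))

      edgeAt : ∀ k → Via (φ (vertex k))
      edgeAt k =
        let f , f∈ , inc , c≡ = find (proj₂ (∈-filter⁻ (Sees? fs i ∘ φ) {xs = allFin n} (∈-lookup k)))
        in f , ∈-filter⁺ (λ f → colour f ℕ.≟ i) f∈ c≡ , inc

      -- An edge met by two distinct vertices joins them. A collision of the edge choice thus yields
      -- a clique edge of colour `i`, and two collisions must come from the same pair because the
      -- copy is rainbow.
      joined : ∀ {u v} (x : Via u) (y : Via v) → u ≢ v →
               index (proj₁ (proj₂ x)) ≡ index (proj₁ (proj₂ y)) → HasColour fs (u , v) i
      joined (f , f∈ , u∈f) (g , g∈ , v∈g) u≢v eq
        with refl ← trans (Any.lookup-index f∈)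
                      (trans (cong (lookup (ofColour i)) eq) (sym (Any.lookup-index g∈)))
        = let f∈fs , c≡ = ∈-filter⁻ (λ f → colour f ℕ.≟ i) f∈
          in lose f∈fs (incident-two u≢v u∈f v∈g , sym c≡)

      unique : ∀ {k l p q} → k ≢ l → p ≢ q → _ → _ → (k , l) ≈ (p , q)
      unique k≢l p≢q eq eq′ =
        Sum.map (Product.map vertex-injective vertex-injective)
                (Product.map vertex-injective vertex-injective)
          (rainbow (k≢l ∘ vertex-injective) (p≢q ∘ vertex-injective)
            (joined (edgeAt _) (edgeAt _) (k≢l ∘ vertex-injective ∘ injective) eq)
            (joined (edgeAt _) (edgeAt _) (p≢q ∘ vertex-injective ∘ injective) eq′))

    -- Two vertices blind for colour `suc k` are joined by an edge with a colour between `1` and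
    -- `k`. These colours are distinct in a rainbow copy, so the pairs of blind vertices inject into
    -- `Fin k`.
    tri-blind : ∀ k → tri (length (blind (suc k))) ≤ k
    tri-blind k = subst (_≤ k) (length-pairs (blind (suc k))) (Fin.injective⇒≤ {f = pred-colour} distinct)
      where
      ps : List (Pair n)
      ps = pairs (blind (suc k))

      unique : Unique (blind (suc k))
      unique = Unique.filter⁺ (¬? ∘ Sees? fs (suc k) ∘ φ) (Unique.allFin⁺ n)

      Coloured : Pair n → Set
      -- First-Fit colours start at 1; the predecessor `c` of the colour is recorded so that it lies
      -- in `Fin k`.
      Coloured (u , v) = u ≢ v × ∃[ c ] (c < k × HasColour fs (φ u , φ v) (suc c))

      classify : ∀ {u v} → u ≢ v × ¬ Sees fs (suc k) (φ u) × ¬ Sees fs (suc k) (φ v) → Coloured (u , v)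
      classify (u≢v , ¬u , ¬v) with edges u≢v
      ... | zero  , p = let 1≤c , _ , c≡ = All.lookupAny (FirstFit⇒1≤colour isGame) p
                        in contradiction c≡ (ℕ.<⇒≢ 1≤c)
      ... | suc c , p = u≢v , c , ℕ.≤-pred (unseen⇒colour< isGame (s≤s z≤n) p ¬u ¬v) , p

      all-coloured : All Coloured ps
      all-coloured = All.map classify (pairs-All (AllPairs.zip
        (unique , All⇒AllPairs (All.all-filter (¬? ∘ Sees? fs (suc k) ∘ φ) (allFin n)))))

      at : ∀ i → Coloured (lookup ps i)
      at i = All.lookup all-coloured (∈-lookup i)

      pred-colour : Fin (length ps) → Fin k
      pred-colour i = let _ , _ , c<k , _ = at i in fromℕ< c<k

      distinct : ∀ {i j} → pred-colour i ≡ pred-colour j → i ≡ j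
      distinct {i} {j} eq =
        let u≢v , c , c<k , p = at i
            x≢y , d , d<k , q = at j
            c≡d = Fin.fromℕ<-injective c d c<k d<k eq
        in AllPairs-lookup-injective ≈-sym (pairs-distinct unique) i j
             (rainbow u≢v x≢y p (subst (HasColour fs _ ∘ suc) (sym c≡d) q))

    upTo-suc : ∀ k → length (upTo k) + length (ofColour (suc k)) ≤ length (upTo (suc k))
    upTo-suc k = length-filter-disjoint (λ f → colour f ℕ.≤? k) (λ f → colour f ℕ.≟ suc k)
      (λ f → colour f ℕ.≤? suc k) ℕ.m≤n⇒m≤1+n ℕ.≤-reflexive (λ c≤k c≡ → ℕ.<⇒≢ (s≤s c≤k) c≡) fs

    -- Here `d = n - 1 - s`. The clique vertices split into at most `s` blind ones and at most one
    -- more seeing vertex than there are edges of the colour.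
    length-ofColour : ∀ {s d k} → suc s + d ≡ n → k < tri (suc s) → d ≤ length (ofColour (suc k))
    length-ofColour {s} {d} {k} refl k<tri = ℕ.+-cancelˡ-≤ (suc s) _ _ (begin
      suc s + d                                                ≡⟨ length-tabulate id ⟨
      length (allFin n)                                        ≡⟨ length-filter-+¬ (Sees? fs (suc k) ∘ φ) (allFin n) ⟩
      length (seeing (suc k)) + length (blind (suc k))         ≤⟨ ℕ.+-mono-≤ (length-seeing (suc k)) blind≤s ⟩
      suc (length (ofColour (suc k))) + s                      ≡⟨ cong suc (ℕ.+-comm _ s) ⟩
      suc s + length (ofColour (suc k))                        ∎)
      where
      open ℕ.≤-Reasoning
      blind≤s : length (blind (suc k)) ≤ s
      -- With `suc s` blind vertices, `tri-blind` would force `tri (suc s) ≤ k`.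
      blind≤s = ℕ.≮⇒≥ λ s< → ℕ.<⇒≱ k<tri (ℕ.≤-trans (tri-mono s<) (tri-blind k))

    -- Since `tri (suc s) = s + tri s`, the block of `s` consists of the `s` colours after `tri s`,
    -- and each of them contributes at least `d` edges.
    upTo-block : ∀ {s d} → suc s + d ≡ n → ∀ j → j ≤ s →
                 length (upTo (tri s)) + j * d ≤ length (upTo (j + tri s))
    upTo-block eq zero _ = ℕ.≤-reflexive (ℕ.+-identityʳ _)
    upTo-block {s} {d} eq (suc j) j<s = begin
      length (upTo (tri s)) + (d + j * d)
        ≡⟨ lemma (length (upTo (tri s))) d (j * d) ⟩
      (length (upTo (tri s)) + j * d) + d
        ≤⟨ ℕ.+-mono-≤ (upTo-block eq j (ℕ.<⇒≤ j<s)) (length-ofColour eq (ℕ.+-monoˡ-< (tri s) j<s)) ⟩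
      length (upTo (j + tri s)) + length (ofColour (suc (j + tri s)))
        ≤⟨ upTo-suc (j + tri s) ⟩
      length (upTo (suc j + tri s)) ∎
      where
      open ℕ.≤-Reasoning
      lemma : ∀ a d b → a + (d + b) ≡ (a + b) + d
      lemma = solve-∀

    -- Summing s (n - 1 - s) over the blocks of colours, in a subtraction-free form.
    upTo-tri : ∀ s d → suc s + d ≡ n →
               suc s * s * (s + 3 * d) ≤ 6 * length (upTo (tri (suc s))) + suc s * s
    -- For `s + d = n - 1`, the sum of `r (n - 1 - r)` over `r ≤ s` is
    -- `s (s + 1) (s + 3 d - 1) / 6`; the term with `- 1` is moved to the right as `suc s * s`.
    upTo-tri zero    d eq = z≤n
    upTo-tri (suc s) d eq = begin
      suc (suc s) * suc s * (suc s + 3 * d)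
        ≡⟨ split s d ⟩
      suc s * s * (s + 3 * suc d) + (6 * (suc s * d) + 2 * suc s)
        -- As `n` is fixed, passing to the previous block raises `d` by one.
        ≤⟨ ℕ.+-monoˡ-≤ _ (upTo-tri s (suc d) (trans (ℕ.+-suc (suc s) d) eq)) ⟩
      6 * length (upTo (tri (suc s))) + suc s * s + (6 * (suc s * d) + 2 * suc s)
        ≡⟨ merge (length (upTo (tri (suc s)))) s d ⟩
      6 * (length (upTo (tri (suc s))) + suc s * d) + suc (suc s) * suc s
        ≤⟨ ℕ.+-monoˡ-≤ _ (ℕ.*-monoʳ-≤ 6 (upTo-block eq (suc s) ℕ.≤-refl)) ⟩
      6 * length (upTo (tri (suc (suc s)))) + suc (suc s) * suc s ∎
      where
      open ℕ.≤-Reasoning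
      split : ∀ s d → suc (suc s) * suc s * (suc s + 3 * d) ≡
                      suc s * s * (s + 3 * suc d) + (6 * (suc s * d) + 2 * suc s)
      split = solve-∀
      merge : ∀ l s d → 6 * l + suc s * s + (6 * (suc s * d) + 2 * suc s) ≡
                        6 * (l + suc s * d) + suc (suc s) * suc s
      merge = solve-∀

  -- With `n = suc p` this is `6 C(n,3) ≤ 6 t`, as `n p p - n p = n (n - 1) (n - 2)`. It is the
  -- block sum taken up to `s = p`, where `d = 0`.
  canForce⇒≤ : ∀ {p t} → BuilderCanForce (K (suc p)) t → suc p * p * p ≤ 6 * t + suc p * p
  canForce⇒≤ {p} (_ , fs , isGame , refl , copy) = begin
    suc p * p * p                              ≡⟨ cong (suc p * p *_) (ℕ.+-identityʳ p) ⟨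
    suc p * p * (p + 3 * 0)                    ≤⟨ upTo-tri p 0 (ℕ.+-identityʳ (suc p)) ⟩
    6 * length (upTo (tri (suc p))) + suc p * p ≤⟨ ℕ.+-monoˡ-≤ _ (ℕ.*-monoʳ-≤ 6 upTo≤) ⟩
    6 * length fs + suc p * p                  ∎
    where
    open LowerBound isGame copy
    open ℕ.≤-Reasoning
    upTo≤ : length (upTo (tri (suc p))) ≤ length fs
    upTo≤ = length-filter (λ f → colour f ℕ.≤? tri (suc p)) fs

-- Asymptotics

open FirstFitCliques
open import Data.Integer as ℤ using (+_; +[1+_])
import Data.Integer.Properties as ℤ
import Data.Integer.Tactic.RingSolver as ℤ-Solver
open import Data.Rational as ℚ using (ℚ; mkℚ; 0ℚ; 1ℚ; _/_; _+_; _*_; -_; ∣_∣)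
import Data.Rational.Properties as ℚ
open import Data.Rational.Unnormalised as ℚᵘ using (mkℚᵘ; _≃_; *≡*; *<*)
import Data.Rational.Unnormalised.Properties as ℚᵘ

abstract
  arff : ∀ n → ∃ (IsAR-FF (K n))
  arff n = Least-search (BuilderCanForce? (K n)) (canForce-gameLength n)

-- Builder's strategy costs `(n³ - n) / 6`, which stays below the main term. Hence the truncated
-- subtraction in `deficit` is exact.
6*arff≤n³ : ∀ n → 6 ℕ.* proj₁ (arff n) ≤ n ^ 3
6*arff≤n³ n = let t , _ , least = arff n in begin
  6 ℕ.* t                  ≤⟨ ℕ.*-monoʳ-≤ 6 (least _ (canForce-gameLength n)) ⟩
  6 ℕ.* gameLength n       ≤⟨ ℕ.m≤m+n _ n ⟩
  6 ℕ.* gameLength n ℕ.+ n  ≡⟨ 6*gameLength n ⟩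
  n ℕ.* n ℕ.* n             ≡⟨ cube n ⟩
  n ^ 3                   ∎
  where
  open ℕ.≤-Reasoning
  cube : ∀ n → n ℕ.* n ℕ.* n ≡ n ℕ.* (n ℕ.* (n ℕ.* 1))
  cube = solve-∀

deficit : ℕ → ℕ
deficit n = n ^ 3 ∸ 6 ℕ.* proj₁ (arff n)

deficit-+ : ∀ n → deficit n ℕ.+ 6 ℕ.* proj₁ (arff n) ≡ n ^ 3
deficit-+ n = ℕ.m∸n+n≡m (6*arff≤n³ n)

-- The lower bound leaves `n³ - n (n - 1) (n - 2) = 3 n² - 2 n`; adding `2 n` gives the simpler
-- bound.
deficit≤3n² : ∀ n → .{{NonZero n}} → deficit n ≤ 3 ℕ.* (n ℕ.* n)
deficit≤3n² (suc p) = let t , forces , _ = arff (suc p) in ℕ.m≤n+o⇒m∸n≤o _ (6 ℕ.* t) (begin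
  suc p ^ 3
    ≡⟨ expand p ⟩
  suc p ℕ.* p ℕ.* p ℕ.+ (2 ℕ.* (suc p ℕ.* p) ℕ.+ suc p)
    ≤⟨ ℕ.+-monoˡ-≤ _ (canForce⇒≤ forces) ⟩
  6 ℕ.* t ℕ.+ suc p ℕ.* p ℕ.+ (2 ℕ.* (suc p ℕ.* p) ℕ.+ suc p)
    ≤⟨ ℕ.m≤m+n _ (2 ℕ.* suc p) ⟩
  6 ℕ.* t ℕ.+ suc p ℕ.* p ℕ.+ (2 ℕ.* (suc p ℕ.* p) ℕ.+ suc p) ℕ.+ 2 ℕ.* suc p
    ≡⟨ collect t p ⟩
  6 ℕ.* t ℕ.+ 3 ℕ.* (suc p ℕ.* suc p) ∎)
  where
  open ℕ.≤-Reasoning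
  expand : ∀ p → suc p ℕ.* (suc p ℕ.* (suc p ℕ.* 1)) ≡ suc p ℕ.* p ℕ.* p ℕ.+ (2 ℕ.* (suc p ℕ.* p) ℕ.+ suc p)
  expand = solve-∀
  collect : ∀ t p → 6 ℕ.* t ℕ.+ suc p ℕ.* p ℕ.+ (2 ℕ.* (suc p ℕ.* p) ℕ.+ suc p) ℕ.+ 2 ℕ.* suc p ≡
                    6 ℕ.* t ℕ.+ 3 ℕ.* (suc p ℕ.* suc p)
  collect = solve-∀

-- Rational form of the error term

toℚᵘ-/ : ∀ i q → ℚ.toℚᵘ (i / suc q) ≃ mkℚᵘ i q
toℚᵘ-/ i q = ℚ.toℚᵘ-fromℚᵘ (mkℚᵘ i q)

-- Dividing `6 t = N - d` by 6 and factoring out `N`. The equation is carried to unnormalised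
-- rationals, where it becomes a cross-multiplied identity of integers.
/-scale : ∀ {t d} N .{{_ : NonZero N}} → d ℕ.+ 6 ℕ.* t ≡ N →
          (+ t) / 1 ≡ ((+ N) / 6) * (1ℚ + - ((+ d) / N))
/-scale {t} {d} (suc q) eq = ℚ.toℚᵘ-injective (begin
  ℚ.toℚᵘ ((+ t) / 1)
    ≈⟨ toℚᵘ-/ (+ t) 0 ⟩
  mkℚᵘ (+ t) 0
    ≈⟨ *≡* (identity (+ t) (+ d) (+ suc q) cast) ⟩
  mkℚᵘ (+ suc q) 5 ℚᵘ.* (ℚᵘ.1ℚᵘ ℚᵘ.+ ℚᵘ.- mkℚᵘ (+ d) q)
    ≈⟨ ℚᵘ.*-cong (toℚᵘ-/ (+ suc q) 5) (ℚᵘ.+-congʳ ℚᵘ.1ℚᵘ (ℚᵘ.-‿cong (toℚᵘ-/ (+ d) q))) ⟨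
  ℚ.toℚᵘ ((+ suc q) / 6) ℚᵘ.* (ℚᵘ.1ℚᵘ ℚᵘ.+ ℚᵘ.- ℚ.toℚᵘ ((+ d) / suc q))
    ≈⟨ ℚᵘ.*-congˡ {ℚ.toℚᵘ ((+ suc q) / 6)} (ℚᵘ.+-congʳ ℚᵘ.1ℚᵘ (ℚ.toℚᵘ-homo‿- ((+ d) / suc q))) ⟨
  ℚ.toℚᵘ ((+ suc q) / 6) ℚᵘ.* (ℚᵘ.1ℚᵘ ℚᵘ.+ ℚ.toℚᵘ (- ((+ d) / suc q)))
    ≈⟨ ℚᵘ.*-congˡ {ℚ.toℚᵘ ((+ suc q) / 6)} (ℚ.toℚᵘ-homo-+ 1ℚ (- ((+ d) / suc q))) ⟨
  ℚ.toℚᵘ ((+ suc q) / 6) ℚᵘ.* ℚ.toℚᵘ (1ℚ + - ((+ d) / suc q))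
    ≈⟨ ℚ.toℚᵘ-homo-* ((+ suc q) / 6) (1ℚ + - ((+ d) / suc q)) ⟨
  ℚ.toℚᵘ (((+ suc q) / 6) * (1ℚ + - ((+ d) / suc q))) ∎)
  where
  open ℚᵘ.≃-Reasoning
  cast : + suc q ≡ + d ℤ.+ + 6 ℤ.* + t
  cast = trans (cong +_ (sym eq)) (cong (ℤ._+_ (+ d)) (ℤ.pos-* 6 t))
  identity : ∀ t d N → N ≡ d ℤ.+ + 6 ℤ.* t →
             t ℤ.* (+ 6 ℤ.* (+ 1 ℤ.* N)) ≡ N ℤ.* (+ 1 ℤ.* N ℤ.+ ℤ.- d ℤ.* + 1) ℤ.* + 1
  identity t d _ refl = expanded t d
    where
    expanded : ∀ t d → let N = d ℤ.+ + 6 ℤ.* t in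
               t ℤ.* (+ 6 ℤ.* (+ 1 ℤ.* N)) ≡ N ℤ.* (+ 1 ℤ.* N ℤ.+ ℤ.- d ℤ.* + 1) ℤ.* + 1
    expanded = ℤ-Solver.solve-∀

/-small : ∀ ε → 0ℚ ℚ.< ε →
          ∃[ k ] (∀ d N .{{_ : NonZero N}} → k ℕ.* d < N → (+ d) / N ℚ.< ε)
/-small ε 0<ε with ε | ℚ.positive 0<ε
-- A positive `ε` has numerator at least 1, so it is at least `1 / suc b`; taking `k = suc b` puts
-- `d / N` below that.
... | ε@(mkℚ +[1+ a ] b _) | _ = suc b , small
  where
  small : ∀ d N .{{_ : NonZero N}} → suc b ℕ.* d < N → (+ d) / N ℚ.< ε
  small d (suc q) bd<N = ℚ.toℚᵘ-cancel-< (begin-strict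
    ℚ.toℚᵘ ((+ d) / suc q) ≃⟨ toℚᵘ-/ (+ d) q ⟩
    mkℚᵘ (+ d) q           <⟨ *<* cross ⟩
    ℚ.toℚᵘ ε               ∎)
    where
    open ℚᵘ.≤-Reasoning
    cross : + d ℤ.* + suc b ℤ.< + suc a ℤ.* + suc q
    cross = subst₂ ℤ._<_ (ℤ.pos-* d (suc b)) (ℤ.pos-* (suc a) (suc q)) (ℤ.+<+
      (ℕ.<-≤-trans (subst (_< suc q) (ℕ.*-comm (suc b) d) bd<N) (ℕ.m≤n*m (suc q) (suc a))))

-- The value at `zero` is a default, as the quotient by `n³` makes sense only for positive `n`.
error : ℕ → ℚ
error zero    = 0ℚ
error (suc p) = - ((+ deficit (suc p)) / (suc p ^ 3)) {{ℕ.m^n≢0 (suc p) 3}}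

error→0 : TendsToZero error
-- For `n > 3 k` the bound on the deficit gives `k * deficit n ≤ 3 k n² < n³`, whence the threshold
-- `suc (k * 3)`.
error→0 ε 0<ε with k , small ← /-small ε 0<ε = suc (k ℕ.* 3) , bound
  where
  bound : ∀ n → suc (k ℕ.* 3) ≤ n → ∣ error n ∣ ℚ.< ε
  bound n@(suc p) 3k<n = begin-strict
    ∣ - x ∣  ≡⟨ ℚ.∣-p∣≡∣p∣ x ⟩
    ∣ x ∣    ≡⟨ ℚ.0≤p⇒∣p∣≡p (ℚ.nonNegative⁻¹ x {{ℚ.normalize-nonNeg (deficit n) (n ^ 3)}}) ⟩
    x        <⟨ small (deficit n) (n ^ 3) k*deficit<n³ ⟩
    ε        ∎
    where
    open ℚ.≤-Reasoning
    instance
      n³≢0 : NonZero (n ^ 3)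
      n³≢0 = ℕ.m^n≢0 n 3
    x : ℚ
    x = (+ deficit n) / (n ^ 3)
    k*deficit<n³ : k ℕ.* deficit n < n ^ 3
    k*deficit<n³ = ℕ.≤-<-trans (ℕ.*-monoʳ-≤ k (deficit≤3n² n))
      (subst (_< n ^ 3) (ℕ.*-assoc k 3 (n ℕ.* n))
        (subst (k ℕ.* 3 ℕ.* (n ℕ.* n) <_) (cong (λ m → n ℕ.* (n ℕ.* m)) (sym (ℕ.*-identityʳ n)))
          (ℕ.*-monoˡ-< (n ℕ.* n) 3k<n)))

theorem16 : ∃ λ (o : ℕ → ℚ) → TendsToZero o ×
    (∀ n → 2 ≤ n →
    ∃[ t ] (IsAR-FF (K n) t ×
    (+ t) / 1 ≡ ((+ (n ^ 3)) / 6) * (1ℚ + o n)))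
theorem16 = error , error→0 , λ where
  n@(suc p) _ → proj₁ (arff n) , proj₂ (arff n) ,
    /-scale {proj₁ (arff n)} {deficit n} (n ^ 3) {{ℕ.m^n≢0 n 3}} (deficit-+ n)
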